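{- For every integer $n\ge 1$, the number of two-ball siteswap sequences $t_1t_2\ldots t_n$ of length $n$ with a non-zero throw made at each time step (i.e. $t_i\ge 1$ for all $i$) is $2^n-1$.
   Context: A siteswap sequence of length (period) $n$ is a sequence $t_1t_2\ldots t_n$ of nonnegative integers such that the residues $i+t_i \pmod n$, $1\le i\le n$, are pairwise distinct, i.e. $\{1,\ldots,n\}=\bigcup_{i=1}^n\{i+t_i \pmod n\}$. Its number of balls is the integer $(t_1+\cdots+t_n)/n$; thus a two-ball siteswap sequence has $t_1+\cdots+t_n=2n$. Rotations of a sequence are considered distinct, and sequences of length $n$ are counted whether or not $n$ is their minimal period. -}

module Defs where

open import Data.Fin.Base using (Fin; toℕ)
open import Data.List.Base using (length)
open import Data.List.Membership.Propositional using (_∈_)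
open import Data.List.Relation.Unary.Unique.Propositional using (Unique)
open import Data.Nat.Base using (ℕ; suc; _+_; _*_; _≥_; NonZero)
open import Data.Nat.DivMod using (_%_)
open import Data.Product.Base using (_×_; ∃-syntax)
open import Data.Vec.Base using (Vec; lookup; sum)
open import Function.Bundles using (_⇔_)
open import Function.Definitions using (Injective)
open import Relation.Binary.PropositionalEquality.Core using (_≡_)

-- The entry t_i with 1 ≤ i ≤ n is stored at the index j : Fin n with
-- i = suc (toℕ j).
IsSiteswap : (n : ℕ) → .{{_ : NonZero n}} → Vec ℕ n → Set
IsSiteswap n t =
  Injective _≡_ _≡_ (λ (j : Fin n) → (suc (toℕ j) + lookup t j) % n)

-- (t_1 + ⋯ + t_n) / n = b, with the denominator cleared.
HasBalls : (n b : ℕ) → Vec ℕ n → Set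
HasBalls n b t = sum t ≡ b * n

AllThrowsNonzero : (n : ℕ) → Vec ℕ n → Set
AllThrowsNonzero n t = (j : Fin n) → lookup t j ≥ 1

-- There are exactly k elements of A satisfying P.  Elements are counted
-- through a duplicate-free enumeration rather than as inhabitants of
-- Σ A P, so that distinct proofs of P x do not count separately.
HasCount : {A : Set} → (A → Set) → ℕ → Set
HasCount {A} P k =
  ∃[ xs ] Unique {A = A} xs × (∀ x → x ∈ xs ⇔ P x) × length xs ≡ k

{-# OPTIONS --safe #-}

-- Lowering every throw by one turns the sequences into one-ball siteswaps s.
-- These correspond to nonempty subsets S of ℤ/n: S is the support of s, and for
-- i ∈ S the throw s_i is the cyclic distance from i to the next element of S.
-- Indeed i ↦ i + s_i is injective mod n and fixes the complement of S, so it
-- maps S into S and s_i is at least that distance; both the throws and the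
-- distances sum to n, so equality holds everywhere.
module Submission where

open import Defs
open import Data.Bool.Base using (Bool; true; false; T)
open import Data.Empty using (⊥-elim)
open import Data.Fin.Base using (Fin; zero; suc; toℕ)
open import Data.List.Base using (List; []; _∷_; _++_; map; length)
open import Data.List.Membership.Propositional using (_∈_)
open import Data.List.Membership.Propositional.Properties
  using (∈-map⁺; ∈-map⁻; ∈-++⁺ˡ; ∈-++⁺ʳ; ∈-++⁻)
open import Data.List.Properties using (length-map; length-++)
open import Data.List.Relation.Unary.All as All using ()
open import Data.List.Relation.Unary.AllPairs using ([]; _∷_)
open import Data.List.Relation.Unary.Any using (here; there)
open import Data.List.Relation.Unary.Unique.Propositional using (Unique)
import Data.List.Relation.Unary.Unique.Propositional.Properties as Unique
open import Data.Nat.Base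
  using (ℕ; zero; suc; _+_; _*_; _∸_; _^_; _≤_; _<_; _<ᵇ_; z≤n; s≤s; NonZero)
open import Data.Nat.DivMod using (_%_; %-distribˡ-+; [m+kn]%n≡m%n; m<n⇒m%n≡m; [m+n]%n≡m%n)
open import Data.Nat.Properties
open import Data.Product.Base using (_×_; _,_; ∃-syntax)
open import Data.Sum.Base using (_⊎_; inj₁; inj₂)
open import Data.Vec.Base as Vec using (Vec; []; _∷_; lookup; sum; replicate)
open import Data.Vec.Properties using (∷-injectiveʳ; lookup-map)
open import Data.Vec.Relation.Unary.Any as VecAny using (here; there)
open import Function.Bundles using (mk⇔)
open import Relation.Binary.PropositionalEquality
open import Relation.Nullary using (¬_)

Nonempty : ∀ {m} → Vec Bool m → Set
Nonempty = VecAny.Any T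

private variable
  m : ℕ

-- Remainders and sums

-- Adding `c * n` to `c + z` gives `z + c * suc n`, so the residue of `z` modulo `suc n` is
-- determined by that of `c + z`.
%-cancelˡ-+ : ∀ n .{{_ : NonZero n}} c {x y} → (c + x) % n ≡ (c + y) % n → x % n ≡ y % n
%-cancelˡ-+ (suc n) c {x} {y} eq = begin
  x % suc n                                   ≡⟨ expand x ⟩
  ((c + x) % suc n + (c * n) % suc n) % suc n ≡⟨ cong (λ r → (r + (c * n) % suc n) % suc n) eq ⟩
  ((c + y) % suc n + (c * n) % suc n) % suc n ≡⟨ expand y ⟨
  y % suc n                                   ∎
  where
  open ≡-Reasoning
  expand : ∀ z → z % suc n ≡ ((c + z) % suc n + (c * n) % suc n) % suc n
  expand z = begin
    z % suc n                ≡⟨ [m+kn]%n≡m%n z c (suc n) ⟨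
    (z + c * suc n) % suc n  ≡⟨ cong (λ r → (z + r) % suc n) (*-suc c n) ⟩
    (z + (c + c * n)) % suc n ≡⟨ cong (_% suc n) (+-assoc z c (c * n)) ⟨
    (z + c + c * n) % suc n  ≡⟨ cong (λ r → (r + c * n) % suc n) (+-comm z c) ⟩
    (c + z + c * n) % suc n  ≡⟨ %-distribˡ-+ (c + z) (c * n) (suc n) ⟩
    ((c + z) % suc n + (c * n) % suc n) % suc n ∎

sum-mono-≤ : (u t : Vec ℕ m) → (∀ j → lookup u j ≤ lookup t j) → sum u ≤ sum t
sum-mono-≤ []      []      _   = z≤n
sum-mono-≤ (x ∷ u) (y ∷ t) u≤t = +-mono-≤ (u≤t zero) (sum-mono-≤ u t (λ j → u≤t (suc j)))

≤∧sum≡⇒≡ : (u t : Vec ℕ m) → (∀ j → lookup u j ≤ lookup t j) → sum u ≡ sum t → u ≡ t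
≤∧sum≡⇒≡ []      []      _   _  = refl
≤∧sum≡⇒≡ (x ∷ u) (y ∷ t) u≤t eq =
  cong₂ _∷_ x≡y (≤∧sum≡⇒≡ u t (λ j → u≤t (suc j)) Σu≡Σt)
  where
  x≡y : x ≡ y
  x≡y with m≤n⇒m<n∨m≡n (u≤t zero)
  ... | inj₁ x<y = ⊥-elim (<⇒≢ (+-mono-<-≤ x<y (sum-mono-≤ u t (λ j → u≤t (suc j)))) eq)
  ... | inj₂ p   = p
  Σu≡Σt : sum u ≡ sum t
  Σu≡Σt = +-cancelˡ-≡ x _ _ (trans eq (cong (_+ sum t) (sym x≡y)))

-- Throws determined by a subset

-- The distance from position 0 to the first element of b, where the first
-- element beyond the end of b lies e places after the end.
firstFrom : ℕ → Vec Bool m → ℕ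
firstFrom e []          = e
firstFrom e (true  ∷ b) = 0
firstFrom e (false ∷ b) = suc (firstFrom e b)

throwsFrom : ℕ → Vec Bool m → Vec ℕ m
throwsFrom e []          = []
-- One `suc` leaves the current position, which gives the distance to the next element; the other
-- undoes the lowering by one.
throwsFrom e (true  ∷ b) = suc (suc (firstFrom e b)) ∷ throwsFrom e b
throwsFrom e (false ∷ b) = 1 ∷ throwsFrom e b

-- Wrapping around, the first element beyond the end is the first element of b.
throws : Vec Bool m → Vec ℕ m
throws b = throwsFrom (firstFrom 0 b) b

support : Vec ℕ m → Vec Bool m
support = Vec.map (1 <ᵇ_)

-- Positions count from 0 here, so this is one less than the number reduced in `IsSiteswap`.
landing : Vec ℕ m → Fin m → ℕ
landing t j = toℕ j + lookup t j

support-throwsFrom : ∀ e (b : Vec Bool m) → support (throwsFrom e b) ≡ b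
support-throwsFrom e []          = refl
support-throwsFrom e (true  ∷ b) = cong (true ∷_) (support-throwsFrom e b)
support-throwsFrom e (false ∷ b) = cong (false ∷_) (support-throwsFrom e b)

throws-injective : {b c : Vec Bool m} → throws b ≡ throws c → b ≡ c
throws-injective {b = b} {c} eq =
  trans (sym (support-throwsFrom _ b)) (trans (cong support eq) (support-throwsFrom _ c))

firstFrom-nonempty : ∀ e e′ {b : Vec Bool m} → Nonempty b → firstFrom e b ≡ firstFrom e′ b
firstFrom-nonempty e e′ {true  ∷ b} _          = refl
firstFrom-nonempty e e′ {false ∷ b} (there ne) = cong suc (firstFrom-nonempty e e′ ne)

firstFrom<m : ∀ e {b : Vec Bool m} → Nonempty b → firstFrom e b < m
firstFrom<m e {true  ∷ b} _          = s≤s z≤n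
firstFrom<m e {false ∷ b} (there ne) = s≤s (firstFrom<m e ne)

firstFrom-range : ∀ e (b : Vec Bool m) → firstFrom e b < m ⊎ firstFrom e b ≡ m + e
firstFrom-range e []          = inj₂ refl
firstFrom-range e (true  ∷ b) = inj₁ (s≤s z≤n)
firstFrom-range e (false ∷ b) with firstFrom-range e b
... | inj₁ p = inj₁ (s≤s p)
... | inj₂ p = inj₂ (cong suc p)

throwsFrom-nonzero : ∀ e (b : Vec Bool m) → AllThrowsNonzero m (throwsFrom e b)
throwsFrom-nonzero e (true  ∷ b) zero    = s≤s z≤n
throwsFrom-nonzero e (false ∷ b) zero    = s≤s z≤n
throwsFrom-nonzero e (true  ∷ b) (suc j) = throwsFrom-nonzero e b j
throwsFrom-nonzero e (false ∷ b) (suc j) = throwsFrom-nonzero e b j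

-- The distances between consecutive elements telescope to `m + e` minus `firstFrom e b`, and
-- raising every throw by one adds `m`.
sum-throwsFrom : ∀ e (b : Vec Bool m) → sum (throwsFrom e b) + firstFrom e b ≡ 2 * m + e
sum-throwsFrom e [] = refl
sum-throwsFrom {suc m} e (true ∷ b) = begin
  2 + (firstFrom e b + sum (throwsFrom e b)) + 0 ≡⟨ +-identityʳ _ ⟩
  2 + (firstFrom e b + sum (throwsFrom e b))     ≡⟨ cong (2 +_) (+-comm (firstFrom e b) _) ⟩
  2 + (sum (throwsFrom e b) + firstFrom e b)     ≡⟨ cong (2 +_) (sum-throwsFrom e b) ⟩
  2 + 2 * m + e                                  ≡⟨ cong (_+ e) (*-suc 2 m) ⟨
  2 * suc m + e                                  ∎
  where open ≡-Reasoning
sum-throwsFrom {suc m} e (false ∷ b) = begin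
  1 + (sum (throwsFrom e b) + suc (firstFrom e b)) ≡⟨ cong suc (+-suc (sum (throwsFrom e b)) _) ⟩
  2 + (sum (throwsFrom e b) + firstFrom e b)       ≡⟨ cong (2 +_) (sum-throwsFrom e b) ⟩
  2 + 2 * m + e                                    ≡⟨ cong (_+ e) (*-suc 2 m) ⟨
  2 * suc m + e                                    ∎
  where open ≡-Reasoning

-- After wrapping around, both boundary terms of `sum-throwsFrom` are the position of the first
-- element, and they cancel.
sum-throws : {b : Vec Bool m} → Nonempty b → sum (throws b) ≡ 2 * m
sum-throws {m} {b} ne = +-cancelʳ-≡ (firstFrom 0 b) _ _ (begin
  sum (throws b) + firstFrom 0 b                 ≡⟨ cong (sum (throws b) +_) (firstFrom-nonempty 0 _ ne) ⟩
  sum (throws b) + firstFrom (firstFrom 0 b) b   ≡⟨ sum-throwsFrom _ b ⟩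
  2 * m + firstFrom 0 b                          ∎)
  where open ≡-Reasoning

-- Here `x` is where the lowered throw lands. Only the throw from the last element leaves the
-- window, and it goes exactly to `m + e`.
landing-range : ∀ e (b : Vec Bool m) j →
  ∃[ x ] landing (throwsFrom e b) j ≡ suc x × (x < m ⊎ x ≡ m + e)
landing-range e (false ∷ b) zero = 0 , refl , inj₁ (s≤s z≤n)
landing-range e (true  ∷ b) zero with firstFrom-range e b
... | inj₁ p = _ , refl , inj₁ (s≤s p)
... | inj₂ p = _ , refl , inj₂ (cong suc p)
landing-range e (true  ∷ b) (suc j) with landing-range e b j
... | x , eq , inj₁ p = suc x , cong suc eq , inj₁ (s≤s p)
... | x , eq , inj₂ p = suc x , cong suc eq , inj₂ (cong suc p)
landing-range e (false ∷ b) (suc j) with landing-range e b j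
... | x , eq , inj₁ p = suc x , cong suc eq , inj₁ (s≤s p)
... | x , eq , inj₂ p = suc x , cong suc eq , inj₂ (cong suc p)

landing≢0 : ∀ e (b : Vec Bool m) j → landing (throwsFrom e b) j ≢ 0
landing≢0 e b j eq with landing-range e b j
... | _ , eq′ , _ = 0≢1+n (trans (sym eq) eq′)

-- A ball landing on the first element of b comes from before position 0.
landing≢firstFrom : ∀ e (b : Vec Bool m) j → landing (throwsFrom e b) j ≢ suc (firstFrom e b)
landing≢firstFrom e (true  ∷ b) (suc j) eq = landing≢0 e b j (suc-injective eq)
landing≢firstFrom e (false ∷ b) (suc j) eq = landing≢firstFrom e b j (suc-injective eq)

-- By induction, only position 0 against a later one needs an argument. An element at 0 throws to
-- the next element, which no later throw reaches; a non-element at 0 has a lowered throw that stays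
-- at 0, behind all later positions.
landing-injective : ∀ e (b : Vec Bool m) i j →
  landing (throwsFrom e b) i ≡ landing (throwsFrom e b) j → i ≡ j
landing-injective e b           zero    zero    eq = refl
landing-injective e (true  ∷ b) zero    (suc j) eq = ⊥-elim (landing≢firstFrom e b j (sym (suc-injective eq)))
landing-injective e (false ∷ b) zero    (suc j) eq = ⊥-elim (landing≢0 e b j (sym (suc-injective eq)))
landing-injective e (true  ∷ b) (suc i) zero    eq = ⊥-elim (landing≢firstFrom e b i (suc-injective eq))
landing-injective e (false ∷ b) (suc i) zero    eq = ⊥-elim (landing≢0 e b i (suc-injective eq))
landing-injective e (true  ∷ b) (suc i) (suc j) eq = cong suc (landing-injective e b i j (suc-injective eq))
landing-injective e (false ∷ b) (suc i) (suc j) eq = cong suc (landing-injective e b i j (suc-injective eq))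

throws-isSiteswap : ∀ n .{{_ : NonZero n}} {b : Vec Bool n} → Nonempty b → IsSiteswap n (throws b)
throws-isSiteswap n {b} ne {i} {j} eq
  with landing-range (firstFrom 0 b) b i | landing-range (firstFrom 0 b) b j
... | x , px , rx | y , py , ry =
  landing-injective e b i j (trans px (trans (cong suc x≡y) (sym py)))
  where
  e = firstFrom 0 b

  x%≡y% : x % n ≡ y % n
  -- The 2 combines the indexing from 1 in `IsSiteswap` with the raised throw in `landing-range`.
  x%≡y% = %-cancelˡ-+ n 2 (trans (cong (λ z → suc z % n) (sym px)) (trans eq (cong (λ z → suc z % n) py)))

  -- A landing at `n + e` reduces to `e`, the first element, which no throw reaches without
  -- wrapping.
  no-wrap : ∀ k {z w} → landing (throws b) k ≡ suc z → z < n → w ≡ n + e → z % n ≢ w % n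
  no-wrap k {z} {w} pz z<n refl z≡w = landing≢firstFrom e b k (trans pz (cong suc (begin
    z             ≡⟨ m<n⇒m%n≡m z<n ⟨
    z % n         ≡⟨ z≡w ⟩
    (n + e) % n   ≡⟨ cong (_% n) (+-comm n e) ⟩
    (e + n) % n   ≡⟨ [m+n]%n≡m%n e n ⟩
    e % n         ≡⟨ m<n⇒m%n≡m (firstFrom<m 0 ne) ⟩
    e             ≡⟨ firstFrom-nonempty 0 e ne ⟩
    firstFrom e b ∎)))
    where open ≡-Reasoning

  cases : x < n ⊎ x ≡ n + e → y < n ⊎ y ≡ n + e → x ≡ y
  cases (inj₁ p) (inj₁ q) = trans (sym (m<n⇒m%n≡m p)) (trans x%≡y% (m<n⇒m%n≡m q))
  cases (inj₁ p) (inj₂ q) = ⊥-elim (no-wrap i px p q x%≡y%)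
  cases (inj₂ p) (inj₁ q) = ⊥-elim (no-wrap j py q p (sym x%≡y%))
  cases (inj₂ p) (inj₂ q) = trans p (sym q)

  x≡y : x ≡ y
  x≡y = cases rx ry

-- Every sequence comes from its support

before-first : ∀ e (b : Vec Bool m) p → p < firstFrom e b →
  (∃[ k ] p ≡ toℕ k × lookup b k ≡ false) ⊎ (∃[ q ] p ≡ m + q × q < e)
before-first e []          p       p<e = inj₂ (p , refl , p<e)
before-first e (false ∷ b) zero    _   = inj₁ (zero , refl , refl)
before-first e (false ∷ b) (suc p) (s≤s p<) with before-first e b p p<
... | inj₁ (k , eq , f) = inj₁ (suc k , cong suc eq , f)
... | inj₂ (q , eq , l) = inj₂ (q , cong suc eq , l)

-- A throw `x` below the prescribed one but at least 2 must start at an element, and once lowered it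
-- stops strictly before the next element, hence in a gap.
short-throw : ∀ e (b : Vec Bool m) j x → 2 ≤ x → x < lookup (throwsFrom e b) j →
  (∃[ k ] toℕ j + x ≡ suc (toℕ k) × lookup b k ≡ false) ⊎ (∃[ q ] toℕ j + x ≡ suc (m + q) × q < e)
short-throw e (false ∷ b) zero _ (s≤s _) (s≤s ())
short-throw e (true ∷ b) zero (suc zero) (s≤s ()) _
short-throw e (true ∷ b) zero (suc (suc p)) _ (s≤s (s≤s p<)) with before-first e b p p<
... | inj₁ (k , eq , f) = inj₁ (suc k , cong (λ z → suc (suc z)) eq , f)
... | inj₂ (q , eq , l) = inj₂ (q , cong (λ z → suc (suc z)) eq , l)
short-throw e (true  ∷ b) (suc j) x 2≤x x< with short-throw e b j x 2≤x x<
... | inj₁ (k , eq , f) = inj₁ (suc k , cong suc eq , f)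
... | inj₂ (q , eq , l) = inj₂ (q , cong suc eq , l)
short-throw e (false ∷ b) (suc j) x 2≤x x< with short-throw e b j x 2≤x x<
... | inj₁ (k , eq , f) = inj₁ (suc k , cong suc eq , f)
... | inj₂ (q , eq , l) = inj₂ (q , cong suc eq , l)

short-throw-% : ∀ n .{{_ : NonZero n}} (b : Vec Bool n) j x → 2 ≤ x → x < lookup (throws b) j →
  ∃[ k ] (suc (toℕ j + x)) % n ≡ (2 + toℕ k) % n × lookup b k ≡ false
short-throw-% n b j x 2≤x x< with short-throw (firstFrom 0 b) b j x 2≤x x<
... | inj₁ (k , eq , f) = k , cong (λ z → suc z % n) eq , f
... | inj₂ (q , eq , q<) with before-first 0 b q q<
-- Beyond the end the same subset repeats, so `q` lies before its first element; with end distance 0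
-- the scan cannot run past the end again.
...   | inj₁ (k , refl , f) = k , trans (cong (λ z → suc z % n) eq) wrap , f
  where
  wrap : (2 + (n + toℕ k)) % n ≡ (2 + toℕ k) % n
  wrap = trans (cong (λ z → (2 + z) % n) (+-comm n (toℕ k))) ([m+n]%n≡m%n (2 + toℕ k) n)

lookup-throwsFrom-∉ : ∀ e (b : Vec Bool m) j → lookup b j ≡ false → lookup (throwsFrom e b) j ≡ 1
lookup-throwsFrom-∉ e (false ∷ b) zero    _  = refl
lookup-throwsFrom-∉ e (true  ∷ b) (suc j) eq = lookup-throwsFrom-∉ e b j eq
lookup-throwsFrom-∉ e (false ∷ b) (suc j) eq = lookup-throwsFrom-∉ e b j eq

¬1<⇒≡1 : ∀ {x} → 1 ≤ x → (1 <ᵇ x) ≡ false → x ≡ 1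
¬1<⇒≡1 {suc zero} _ _ = refl

-- If every throw were 1, the sum would be only `m`.
support-nonempty : (t : Vec ℕ m) → AllThrowsNonzero m t → m < sum t → Nonempty (support t)
support-nonempty (zero ∷ t)        nz _       with () ← nz zero
support-nonempty (suc zero ∷ t)    nz (s≤s l) = there (support-nonempty t (λ j → nz (suc j)) l)
support-nonempty (suc (suc _) ∷ t) _  _       = here _

module _ (n : ℕ) .{{_ : NonZero n}} {t : Vec ℕ n}
         (siteswap : IsSiteswap n t) (nonzero : AllThrowsNonzero n t) where

  lookup-∉-support : ∀ j → lookup (support t) j ≡ false → lookup t j ≡ 1
  lookup-∉-support j eq = ¬1<⇒≡1 (nonzero j) (trans (sym (lookup-map j (1 <ᵇ_) t)) eq)

  -- A shorter throw from an element `j` would land in a gap `k`. The throw 1 at `k` has the same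
  -- landing residue, so the siteswap condition forces `j ≡ k`, against `1 < lookup t j`.
  throws-support-≤ : ∀ j → lookup (throws (support t)) j ≤ lookup t j
  throws-support-≤ j with m≤n⇒m<n∨m≡n (nonzero j)
  ... | inj₂ 1≡tⱼ = ≤-reflexive (trans (lookup-throwsFrom-∉ _ (support t) j j∉) 1≡tⱼ)
    where
    j∉ : lookup (support t) j ≡ false
    j∉ = trans (lookup-map j (1 <ᵇ_) t) (cong (1 <ᵇ_) (sym 1≡tⱼ))
  ... | inj₁ 1<tⱼ = ≮⇒≥ too-short
    where
    too-short : ¬ (lookup t j < lookup (throws (support t)) j)
    too-short short with short-throw-% n (support t) j (lookup t j) 1<tⱼ short
    ... | k , eq , k∉ = <⇒≢ 1<tⱼ (sym (trans (cong (lookup t) j≡k) tₖ≡1))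
      where
      tₖ≡1 : lookup t k ≡ 1
      tₖ≡1 = lookup-∉-support k k∉
      collide : (2 + toℕ k) % n ≡ suc (toℕ k + lookup t k) % n
      collide = cong (λ z → suc z % n) (trans (+-comm 1 (toℕ k)) (cong (toℕ k +_) (sym tₖ≡1)))
      j≡k : j ≡ k
      j≡k = siteswap (trans eq collide)

  throws-support : Nonempty (support t) → HasBalls n 2 t → throws (support t) ≡ t
  throws-support ne balls = ≤∧sum≡⇒≡ _ t throws-support-≤ (trans (sum-throws ne) (sym balls))

-- Counting nonempty subsets

nonempties : ∀ m → List (Vec Bool m)
nonempties zero    = []
nonempties (suc m) =
  map (true ∷_) (replicate m false ∷ nonempties m) ++ map (false ∷_) (nonempties m)

-- Counting the empty subset as well keeps truncated subtraction out of the induction.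
length-nonempties : ∀ m → suc (length (nonempties m)) ≡ 2 ^ m
length-nonempties zero    = refl
length-nonempties (suc m) = begin
  -- One unit of the 2 is the empty subset, the other the singleton `true ∷ replicate m false`.
  2 + length (map (true ∷_) xs ++ map (false ∷_) xs)                ≡⟨ cong (2 +_) (length-++ (map (true ∷_) xs)) ⟩
  2 + (length (map (true ∷_) xs) + length (map (false ∷_) xs))      ≡⟨ cong (2 +_) (cong₂ _+_ (length-map _ xs) (length-map _ xs)) ⟩
  2 + (length xs + length xs)                                       ≡⟨ cong suc (+-suc (length xs) _) ⟨
  suc (length xs) + suc (length xs)                                 ≡⟨ cong₂ _+_ ih (trans ih (sym (+-identityʳ _))) ⟩
  2 ^ suc m                                                         ∎
  where
  open ≡-Reasoning
  xs = nonempties m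
  ih = length-nonempties m

nonempties-sound : ∀ {b : Vec Bool m} → b ∈ nonempties m → Nonempty b
nonempties-sound {suc m} b∈ with ∈-++⁻ (map (true ∷_) (replicate m false ∷ nonempties m)) b∈
... | inj₁ p with _ , _ , refl ← ∈-map⁻ (true ∷_) p = here _
... | inj₂ p with _ , c∈ , refl ← ∈-map⁻ (false ∷_) p = there (nonempties-sound c∈)

≡empty⊎nonempty : (b : Vec Bool m) → b ≡ replicate m false ⊎ Nonempty b
≡empty⊎nonempty []          = inj₁ refl
≡empty⊎nonempty (true  ∷ b) = inj₂ (here _)
≡empty⊎nonempty (false ∷ b) with ≡empty⊎nonempty b
... | inj₁ eq = inj₁ (cong (false ∷_) eq)
... | inj₂ ne = inj₂ (there ne)

nonempties-complete : (b : Vec Bool m) → Nonempty b → b ∈ nonempties m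
nonempties-complete {suc m} (false ∷ b) (there ne) =
  ∈-++⁺ʳ (map (true ∷_) (replicate m false ∷ nonempties m)) (∈-map⁺ (false ∷_) (nonempties-complete b ne))
nonempties-complete (true ∷ b) _ with ≡empty⊎nonempty b
... | inj₁ refl = here refl
... | inj₂ ne   = ∈-++⁺ˡ (∈-map⁺ (true ∷_) (there (nonempties-complete b ne)))

empty-not-nonempty : ∀ m → ¬ Nonempty (replicate m false)
empty-not-nonempty (suc m) (there ne) = empty-not-nonempty m ne

nonempties-unique : ∀ m → Unique (nonempties m)
nonempties-unique zero    = []
nonempties-unique (suc m) = Unique.++⁺
  (Unique.map⁺ ∷-injectiveʳ (All.tabulate empty≢ ∷ nonempties-unique m))
  (Unique.map⁺ ∷-injectiveʳ (nonempties-unique m))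
  disjoint
  where
  empty≢ : ∀ {b} → b ∈ nonempties m → replicate m false ≢ b
  empty≢ b∈ refl = empty-not-nonempty m (nonempties-sound b∈)
  disjoint : ∀ {b} → ¬ (b ∈ map (true ∷_) (replicate m false ∷ nonempties m) × b ∈ map (false ∷_) (nonempties m))
  disjoint (p , q) with ∈-map⁻ (true ∷_) p | ∈-map⁻ (false ∷_) q
  ... | _ , _ , refl | _ , _ , ()

mainTheorem4 : (n : ℕ) → .{{_ : NonZero n}} →
    HasCount (λ (t : Vec ℕ n) → IsSiteswap n t × HasBalls n 2 t × AllThrowsNonzero n t) (2 ^ n ∸ 1)
mainTheorem4 n =
  map throws (nonempties n) ,
  Unique.map⁺ throws-injective (nonempties-unique n) ,
  (λ t → mk⇔ sound (complete t)) ,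
  trans (length-map throws (nonempties n)) (cong (_∸ 1) (length-nonempties n))
  where
  Good : Vec ℕ n → Set
  Good t = IsSiteswap n t × HasBalls n 2 t × AllThrowsNonzero n t

  sound : ∀ {t} → t ∈ map throws (nonempties n) → Good t
  sound t∈ with b , b∈ , refl ← ∈-map⁻ throws t∈ =
    throws-isSiteswap n ne , sum-throws ne , throwsFrom-nonzero _ b
    where ne = nonempties-sound b∈

  complete : ∀ t → Good t → t ∈ map throws (nonempties n)
  complete t (siteswap , balls , nonzero) =
    subst (_∈ map throws (nonempties n)) (throws-support n siteswap nonzero ne balls)
      (∈-map⁺ throws (nonempties-complete (support t) ne))
    where
    ne : Nonempty (support t)
    -- As `n` is positive, the sum `2 * n` exceeds `n`.
    ne = support-nonempty t nonzero (subst (n <_) (trans (*-comm n 2) (sym balls)) (m<m*n n 2 (s≤s (s≤s z≤n))))
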